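{- Let $K_{m,n}$ be a complete bipartite graph with $1<m\le n$. (i) If $m<n$, then $\operatorname{st}_{\gamma_{st}}(K_{m,n})=1$. (ii) If $m=n\ge 4$, then $\operatorname{st}_{\gamma_{st}}(K_{n,n})=1$.
   Context: All graphs are finite, simple and undirected. For a graph $G=(V,E)$, a set $D\subseteq V$ is a strong dominating set if every vertex $v\in V\setminus D$ is adjacent to some $u\in D$ with $\deg(v)\le\deg(u)$ (degrees taken in $G$). The strong domination number $\gamma_{st}(G)$ is the minimum size of a strong dominating set. For $S\subseteq V$, $G-S$ is the graph obtained by deleting the vertices of $S$. The stability of the strong domination number is $\operatorname{st}_{\gamma_{st}}(G)=\min\{|S| : S\subseteq V,\ \gamma_{st}(G-S)\ne\gamma_{st}(G)\}$. -}

module Defs where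

open import Data.Fin using (Fin; toℕ)
open import Data.Fin.Properties using (all?; any?)
open import Data.Fin.Subset
  using (Subset; inside; outside; ⊤; _∈_; _∉_; _⊆_; _─_; ∣_∣)
open import Data.Fin.Subset.Properties
  using (_∈?_; _⊆?_; ∈⊤; x∈p∧x∉q⇒x∈p─q; ∣p∣≤n)
open import Data.List using (List; []; _∷_; _++_; map; filter)
open import Data.List.Extrema.Nat using (min; min≤v⁺; argmin-sel)
import Data.List.Membership.Propositional as List
open import Data.List.Membership.Propositional using (lose)
open import Data.List.Membership.Propositional.Properties
  using (∈-map⁺; ∈-++⁺ˡ; ∈-++⁺ʳ; ∈-map∘filter⁺; ∈-map∘filter⁻)
open import Data.List.Relation.Unary.Any using (here)
open import Data.Nat using (ℕ; zero; suc; _+_; _≤_; _<_; _≤?_; _<?_; _≟_)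
open import Data.Nat.Properties using (≤-refl; <⇒≱; ≤-trans; <-irrefl)
open import Data.Product using (_×_; _,_; ∃-syntax)
open import Data.Sum using (_⊎_; inj₁; inj₂)
import Data.Vec as Vec
open import Function using (id)
open import Relation.Binary.Definitions using (Symmetric; Irreflexive)
import Relation.Binary.Definitions as Binary
open import Relation.Binary.PropositionalEquality
  using (_≡_; _≢_; refl; sym; subst)
open import Relation.Nullary using (does; contradiction)
open import Relation.Nullary.Decidable using (¬?; _×-dec_; _⊎-dec_; _→-dec_)
open import Relation.Unary using (Pred; Decidable)

-- The vertex set is a subset of an ambient Fin N, so that deleting vertices
-- does not require renumbering the remaining ones.
record Graph (N : ℕ) : Set₁ where
  field
    V         : Subset N
    Adj       : Fin N → Fin N → Set
    Adj?      : Binary.Decidable Adj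
    Adj-sym   : Symmetric Adj
    Adj-irr   : Irreflexive _≡_ Adj
    Adj⇒∈V    : ∀ {u v} → Adj u v → u ∈ V

  neighbours : Fin N → Subset N
  neighbours v = Vec.tabulate λ u → does (Adj? v u)

  deg : Fin N → ℕ
  deg v = ∣ neighbours v ∣

open Graph

infixl 5 _-ᴳ_

_-ᴳ_ : ∀ {N} → Graph N → Subset N → Graph N
G -ᴳ S = record
  { V       = V G ─ S
  ; Adj     = λ u v → Adj G u v × u ∉ S × v ∉ S
  ; Adj?    = λ u v → Adj? G u v ×-dec ¬? (u ∈? S) ×-dec ¬? (v ∈? S)
  ; Adj-sym = λ (uv , u∉S , v∉S) → Adj-sym G uv , v∉S , u∉S
  ; Adj-irr = λ u≡v (uv , _) → Adj-irr G u≡v uv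
  ; Adj⇒∈V  = λ (uv , u∉S , _) → x∈p∧x∉q⇒x∈p─q (Adj⇒∈V G uv) u∉S
  }

IsStrongDominating : ∀ {N} → Graph N → Subset N → Set
IsStrongDominating G D =
  D ⊆ V G ×
  (∀ v → v ∈ V G → v ∉ D → ∃[ u ] (u ∈ D × Adj G v u × deg G v ≤ deg G u))

isStrongDominating? : ∀ {N} (G : Graph N) → Decidable (IsStrongDominating G)
isStrongDominating? G D =
  (D ⊆? V G) ×-dec
  all? λ v → (v ∈? V G) →-dec ¬? (v ∈? D) →-dec
    any? λ u → (u ∈? D) ×-dec Adj? G v u ×-dec (deg G v ≤? deg G u)

subsets : ∀ N → List (Subset N)
subsets zero    = Vec.[] ∷ []
subsets (suc N) =
  map (inside Vec.∷_) (subsets N) ++ map (outside Vec.∷_) (subsets N)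

-- The minimum of ∣ S ∣ over the subsets S satisfying P; the out-of-range
-- value suc N is returned exactly when there is no such subset.
minSize : ∀ {N ℓ} {P : Pred (Subset N) ℓ} → Decidable P → ℕ
minSize {N} P? = min (suc N) (map ∣_∣ (filter P? (subsets N)))

∈-subsets : ∀ {N} (S : Subset N) → S List.∈ subsets N
∈-subsets Vec.[]              = here refl
∈-subsets (inside  Vec.∷ S)   = ∈-++⁺ˡ (∈-map⁺ _ (∈-subsets S))
∈-subsets (outside Vec.∷ S)   = ∈-++⁺ʳ _ (∈-map⁺ _ (∈-subsets S))

minSize-≤ : ∀ {N ℓ} {P : Pred (Subset N) ℓ} (P? : Decidable P) →
            ∀ {S} → P S → minSize P? ≤ ∣ S ∣
minSize-≤ {N} P? {S} p = min≤v⁺ (suc N) _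
  (inj₂ (lose (∈-map∘filter⁺ ∣_∣ P? (S , ∈-subsets S , refl , p)) ≤-refl))

minSize-attained : ∀ {N ℓ} {P : Pred (Subset N) ℓ} (P? : Decidable P) →
                   ∀ {S} → P S → ∃[ M ] (P M × ∣ M ∣ ≡ minSize P?)
minSize-attained {N} P? {S} p
  with argmin-sel id (suc N) (map ∣_∣ (filter P? (subsets N)))
... | inj₁ eq = contradiction
      (≤-trans (subst (_≤ ∣ S ∣) eq (minSize-≤ P? p)) (∣p∣≤n S))
      (<-irrefl refl)
... | inj₂ m∈
  with M , _ , eq , pM ← ∈-map∘filter⁻ ∣_∣ P? {xs = subsets N} m∈
  = M , pM , sym eq

-- A strong dominating set always exists, since V G itself is one.
γst : ∀ {N} → Graph N → ℕ
γst G = minSize (isStrongDominating? G)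

ChangesγstBy : ∀ {N} → Graph N → Subset N → Set
ChangesγstBy G S = S ⊆ V G × γst (G -ᴳ S) ≢ γst G

changesγstBy? : ∀ {N} (G : Graph N) → Decidable (ChangesγstBy G)
changesγstBy? G S = (S ⊆? V G) ×-dec ¬? (γst (G -ᴳ S) ≟ γst G)

-- If G has a vertex then S = V G qualifies: γst of the null graph is 0, while
-- γst G is positive.  Only for the null graph is the minimum over no sets.
stγst : ∀ {N} → Graph N → ℕ
stγst G = minSize (changesγstBy? G)

-- The parts are {0, …, m-1} and {m, …, m+n-1}.
K : (m n : ℕ) → Graph (m + n)
K m n = record
  { V       = ⊤
  ; Adj     = λ u v → (toℕ u < m × m ≤ toℕ v) ⊎ (m ≤ toℕ u × toℕ v < m)
  ; Adj?    = λ u v → ((toℕ u <? m) ×-dec (m ≤? toℕ v)) ⊎-dec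
                      ((m ≤? toℕ u) ×-dec (toℕ v <? m))
  ; Adj-sym = λ where
      (inj₁ (u<m , m≤v)) → inj₂ (m≤v , u<m)
      (inj₂ (m≤u , v<m)) → inj₁ (v<m , m≤u)
  ; Adj-irr = λ where
      refl (inj₁ (u<m , m≤u)) → <⇒≱ u<m m≤u
      refl (inj₂ (m≤u , u<m)) → <⇒≱ u<m m≤u
  ; Adj⇒∈V  = λ _ → ∈⊤
  }

{-# OPTIONS --safe #-}

-- Write A for the part of size m.  If S ⊆ A leaves 0 < ∣ A ─ S ∣ < n, then in
-- K m n -ᴳ S the vertices of A ─ S have degree n and all others have degree
-- ∣ A ─ S ∣, so A ─ S is dominated only by itself while it dominates everything:
-- γst = ∣ A ─ S ∣.  Taking S = ∅ and S a single vertex settles m < n.  For m = n,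
-- one vertex from each part gives γst (K n n) ≤ 2, whereas deleting a vertex
-- makes γst equal to n - 1 ≥ 3.
module Submission where

open import Defs
open import Data.Bool using (true)
open import Data.Fin using (Fin; zero; suc; toℕ; _↑ʳ_)
open import Data.Fin.Properties using (toℕ-↑ʳ)
open import Data.Fin.Subset
  using (Subset; inside; outside; ⊥; _∈_; _∉_; _⊆_; _─_; _-_; ∁; ⁅_⁆; ∣_∣; Nonempty)
open import Data.Fin.Subset.Properties
open import Data.Nat
  using (ℕ; zero; suc; _+_; _≤_; _<_; s≤s; z<s; s≤s⁻¹; _<?_)
open import Data.Nat.Properties hiding (_<?_)
open import Data.Product using (_×_; _,_; proj₁; proj₂)
open import Data.Sum using (inj₁; inj₂)
open import Data.Vec using ([]; _∷_; here; there; tabulate)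
open import Data.Vec.Properties using ([]=⇒lookup; lookup⇒[]=; lookup∘tabulate)
open import Function using (_∘_; id)
open import Level using (Level)
open import Relation.Binary.PropositionalEquality
  using (_≡_; refl; sym; trans; cong; subst)
open import Relation.Nullary using (Dec; does; yes; no; contradiction)
open import Relation.Nullary.Decidable using (dec-true)
open import Relation.Unary using (Pred; Decidable)

open Graph

private
  variable
    N : ℕ
    ℓ : Level

-- Subsets and minimum sizes.

does⇒ : ∀ {P : Set ℓ} (P? : Dec P) → does P? ≡ true → P
does⇒ (yes p) _ = p

⟦_⟧ : {P : Pred (Fin N) ℓ} → Decidable P → Subset N
⟦ P? ⟧ = tabulate (does ∘ P?)

∈⟦⟧⁺ : {P : Pred (Fin N) ℓ} (P? : Decidable P) {u : Fin N} → P u → u ∈ ⟦ P? ⟧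
∈⟦⟧⁺ P? {u} p = lookup⇒[]= u _ (trans (lookup∘tabulate _ u) (dec-true (P? u) p))

∈⟦⟧⁻ : {P : Pred (Fin N) ℓ} (P? : Decidable P) {u : Fin N} → u ∈ ⟦ P? ⟧ → P u
∈⟦⟧⁻ P? {u} u∈ = does⇒ (P? u) (trans (sym (lookup∘tabulate _ u)) ([]=⇒lookup u∈))

x∈p─q⇒x∉q : (p q : Subset N) {x : Fin N} → x ∈ p ─ q → x ∉ q
x∈p─q⇒x∉q (_ ∷ _) (outside ∷ _) here       ()
x∈p─q⇒x∉q (_ ∷ p) (_ ∷ q)       (there x∈) (there x∈q) = x∈p─q⇒x∉q p q x∈ x∈q

∣p∣≡0⇒p≡⊥ : (p : Subset N) → ∣ p ∣ ≡ 0 → p ≡ ⊥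
∣p∣≡0⇒p≡⊥ []            _  = refl
∣p∣≡0⇒p≡⊥ (outside ∷ p) eq = cong (outside ∷_) (∣p∣≡0⇒p≡⊥ p eq)

-- The witness `S` rules out the default value `suc N`: were `P` empty, the bound on its members
-- would hold for every `k`.
minSize-≥ : {P : Pred (Subset N) ℓ} (P? : Decidable P) {S : Subset N} → P S →
            ∀ {k} → (∀ {T} → P T → k ≤ ∣ T ∣) → k ≤ minSize P?
minSize-≥ P? pS bound with _ , pM , eq ← minSize-attained P? pS =
  subst (_ ≤_) eq (bound pM)

-- Bounds on strong domination numbers and degrees.

V-isStrongDominating : (G : Graph N) → IsStrongDominating G (V G)
V-isStrongDominating G = id , λ _ v∈V v∉V → contradiction v∈V v∉V

γst-≤ : (G : Graph N) {D : Subset N} → IsStrongDominating G D → γst G ≤ ∣ D ∣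
γst-≤ G = minSize-≤ (isStrongDominating? G)

γst-≥ : (G : Graph N) → ∀ {k} →
        (∀ {D} → IsStrongDominating G D → k ≤ ∣ D ∣) → k ≤ γst G
γst-≥ G = minSize-≥ (isStrongDominating? G) (V-isStrongDominating G)

deg-≥ : (G : Graph N) (v : Fin N) {p : Subset N} →
        (∀ {u} → u ∈ p → Adj G v u) → ∣ p ∣ ≤ deg G v
deg-≥ G v p⊆ = p⊆q⇒∣p∣≤∣q∣ (∈⟦⟧⁺ (Adj? G v) ∘ p⊆)

deg-≤ : (G : Graph N) (v : Fin N) {p : Subset N} →
        (∀ {u} → Adj G v u → u ∈ p) → deg G v ≤ ∣ p ∣
deg-≤ G v ⊆p = p⊆q⇒∣p∣≤∣q∣ (⊆p ∘ ∈⟦⟧⁻ (Adj? G v))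

module _ (G H : Graph N) (V≡ : V G ≡ V H)
         (to : ∀ {u v} → Adj G u v → Adj H u v)
         (from : ∀ {u v} → Adj H u v → Adj G u v) where

  -- Graphs with the same vertices and equivalent adjacency need not be equal records, so the
  -- property is transported by hand; degrees agree because each neighbour set contains the other.
  isStrongDominating-resp : ∀ {D} → IsStrongDominating G D → IsStrongDominating H D
  isStrongDominating-resp {D} (D⊆V , dom) = subst (D ⊆_) V≡ D⊆V , dom′
    where
    dom′ : ∀ v → v ∈ V H → v ∉ D → _
    dom′ v v∈V v∉D with u , u∈D , vu , d ← dom v (subst (v ∈_) (sym V≡) v∈V) v∉D =
      u , u∈D , to vu ,
      ≤-trans (deg-≤ H v (∈⟦⟧⁺ (Adj? G v) ∘ from))
        (≤-trans d (deg-≥ H u (to ∘ ∈⟦⟧⁻ (Adj? G u))))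

  γst-anti : γst H ≤ γst G
  γst-anti = γst-≥ G (γst-≤ H ∘ isStrongDominating-resp)

γst-∅ : (G : Graph N) → γst (G -ᴳ ⊥) ≡ γst G
γst-∅ G = ≤-antisym
  (γst-anti G (G -ᴳ ⊥) (sym (p─⊥≡p (V G))) (λ uv → uv , ∉⊥ , ∉⊥) proj₁)
  (γst-anti (G -ᴳ ⊥) G (p─⊥≡p (V G)) proj₁ (λ uv → uv , ∉⊥ , ∉⊥))

stγst≡1 : (G : Graph N) (x : Fin N) → ChangesγstBy G ⁅ x ⁆ → stγst G ≡ 1
stγst≡1 G x changes = ≤-antisym
  (subst (stγst G ≤_) (∣⁅x⁆∣≡1 x) (minSize-≤ (changesγstBy? G) changes))
  (minSize-≥ (changesγstBy? G) changes positive)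
  where
  -- A set of size 0 is `⊥`, whose deletion preserves `γst`.
  positive : ∀ {S} → ChangesγstBy G S → 1 ≤ ∣ S ∣
  positive {S} (_ , γ≢) = n≢0⇒n>0 λ ∣S∣≡0 →
    γ≢ (subst (λ T → γst (G -ᴳ T) ≡ γst G) (sym (∣p∣≡0⇒p≡⊥ S ∣S∣≡0)) (γst-∅ G))

-- The two parts of `K m n`.

module _ (m n : ℕ) where

  inA? : Decidable {A = Fin (m + n)} (λ u → toℕ u < m)
  inA? u = toℕ u <? m

  A B : Subset (m + n)
  A = ⟦ inA? ⟧
  B = ∁ A

  ∈B⁺ : ∀ {u} → m ≤ toℕ u → u ∈ B
  ∈B⁺ m≤u = x∉p⇒x∈∁p λ u∈A → ≤⇒≯ m≤u (∈⟦⟧⁻ inA? u∈A)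

  ∈B⁻ : ∀ {u} → u ∈ B → m ≤ toℕ u
  ∈B⁻ u∈B = ≮⇒≥ λ u<m → x∈∁p⇒x∉p u∈B (∈⟦⟧⁺ inA? u<m)

-- Induction works because the tail of `A (suc m) n` computes to `A m n`.
∣A∣≡m : ∀ m n → ∣ A m n ∣ ≡ m
∣A∣≡m zero    n = trans
  (cong ∣_∣ (Empty-unique λ (_ , u∈A) → n≮0 (∈⟦⟧⁻ (inA? 0 n) u∈A))) (∣⊥∣≡0 n)
∣A∣≡m (suc m) n = cong suc (∣A∣≡m m n)

∣B∣≡n : ∀ m n → ∣ B m n ∣ ≡ n
∣B∣≡n m n rewrite ∣∁p∣≡n∸∣p∣ (A m n) | ∣A∣≡m m n = m+n∸m≡n m n

∣A-0∣≡m : ∀ m n → ∣ A (suc m) n - zero ∣ ≡ m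
∣A-0∣≡m m n = trans (cong ∣_∣ (p─⊥≡p (A m n))) (∣A∣≡m m n)

-- Deletion of vertices of `A`.

module _ (m n : ℕ) {S : Subset (m + n)} (S⊆A : S ⊆ A m n) where

  private
    H : Graph (m + n)
    H = K m n -ᴳ S

    A′ : Subset (m + n)
    A′ = A m n ─ S

  ∈A′⁺ : ∀ {u} → toℕ u < m → u ∉ S → u ∈ A′
  ∈A′⁺ u<m u∉S = x∈p∧x∉q⇒x∈p─q (∈⟦⟧⁺ (inA? m n) u<m) u∉S

  ∈A′⁻ : ∀ {u} → u ∈ A′ → toℕ u < m × u ∉ S
  ∈A′⁻ u∈ = ∈⟦⟧⁻ (inA? m n) (p─q⊆p _ S u∈) , x∈p─q⇒x∉q (A m n) S u∈

  B∌S : ∀ {u} → m ≤ toℕ u → u ∉ S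
  B∌S m≤u u∈S = ≤⇒≯ m≤u (∈⟦⟧⁻ (inA? m n) (S⊆A u∈S))

  A′⇒n≤deg : ∀ {v} → v ∈ A′ → n ≤ deg H v
  A′⇒n≤deg {v} v∈ with v<m , v∉S ← ∈A′⁻ v∈ =
    subst (_≤ deg H v) (∣B∣≡n m n) (deg-≥ H v λ u∈B →
      let m≤u = ∈B⁻ m n u∈B in inj₁ (v<m , m≤u) , v∉S , B∌S m≤u)

  B⇒deg≤∣A′∣ : ∀ {v} → m ≤ toℕ v → deg H v ≤ ∣ A′ ∣
  B⇒deg≤∣A′∣ {v} m≤v = deg-≤ H v λ where
    (inj₁ (v<m , _) , _)       → contradiction v<m (≤⇒≯ m≤v)
    (inj₂ (_ , u<m) , _ , u∉S) → ∈A′⁺ u<m u∉S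

  -- The remaining vertices all lie in `B`, so a single `a` in `A′` dominates them: its degree is at
  -- least `n`, theirs at most `∣ A′ ∣`.
  A′-isStrongDominating : Nonempty A′ → ∣ A′ ∣ ≤ n → IsStrongDominating H A′
  A′-isStrongDominating (a , a∈A′) ∣A′∣≤n =
    (λ u∈ → x∈p∧x∉q⇒x∈p─q ∈⊤ (proj₂ (∈A′⁻ u∈))) , λ v v∈V v∉A′ →
    let v∉S       = x∈p─q⇒x∉q (V (K m n)) S v∈V
        m≤v       = ≮⇒≥ λ v<m → v∉A′ (∈A′⁺ v<m v∉S)
        a<m , a∉S = ∈A′⁻ a∈A′
    in a , a∈A′ , (inj₂ (m≤v , a<m) , v∉S , a∉S) ,
       ≤-trans (B⇒deg≤∣A′∣ m≤v) (≤-trans ∣A′∣≤n (A′⇒n≤deg a∈A′))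

  -- If `v` in `A′` were missing from `D`, its dominator `u` would lie in `B`, giving
  -- `n ≤ deg H v ≤ deg H u ≤ ∣ A′ ∣ < n`.
  A′⊆strongDominating : ∣ A′ ∣ < n → ∀ {D} → IsStrongDominating H D → A′ ⊆ D
  A′⊆strongDominating ∣A′∣<n {D} (_ , dom) {v} v∈A′ with v ∈? D
  ... | yes v∈D = v∈D
  ... | no v∉D with v<m , v∉S ← ∈A′⁻ v∈A′
               with dom v (x∈p∧x∉q⇒x∈p─q ∈⊤ v∉S) v∉D
  ...   | _ , _ , (inj₂ (m≤v , _) , _) , _ = contradiction v<m (≤⇒≯ m≤v)
  ...   | _ , _ , (inj₁ (_ , m≤u) , _) , d = contradiction ∣A′∣<n
          (≤⇒≯ (≤-trans (A′⇒n≤deg v∈A′) (≤-trans d (B⇒deg≤∣A′∣ m≤u))))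

  γst-K-S : Nonempty A′ → ∣ A′ ∣ < n → γst H ≡ ∣ A′ ∣
  γst-K-S ne ∣A′∣<n = ≤-antisym
    (γst-≤ H (A′-isStrongDominating ne (<⇒≤ ∣A′∣<n)))
    (γst-≥ H λ dom → p⊆q⇒∣p∣≤∣q∣ (A′⊆strongDominating ∣A′∣<n dom))

-- Values of `γst` and the two cases.

γst-K : ∀ m n → 0 < m → m < n → γst (K m n) ≡ m
γst-K m@(suc _) n _ m<n = trans (sym (γst-∅ (K m n))) (trans
  (γst-K-S m n ⊥⊆ (zero , here) (subst (_< n) (sym ∣A─⊥∣≡m) m<n)) ∣A─⊥∣≡m)
  where
  ∣A─⊥∣≡m : ∣ A m n ─ ⊥ ∣ ≡ m
  ∣A─⊥∣≡m = trans (cong ∣_∣ (p─⊥≡p (A m n))) (∣A∣≡m m n)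

-- The bound is on `m`, the size of the part after deletion, so `suc m ≡ n` is allowed; the balanced
-- case is exactly this one.
γst-K-0 : ∀ m n → 0 < m → m < n → γst (K (suc m) n -ᴳ ⁅ zero ⁆) ≡ m
γst-K-0 m@(suc _) n _ m<n = trans
  (γst-K-S (suc m) n 0⊆A (suc zero , there here)
    (subst (_< n) (sym (∣A-0∣≡m m n)) m<n))
  (∣A-0∣≡m m n)
  where
  0⊆A : ⁅ zero ⁆ ⊆ A (suc m) n
  0⊆A x∈ with refl ← x∈⁅y⁆⇒x≡y zero x∈ = here

γst-Kₙₙ≤2 : ∀ n → 0 < n → γst (K n n) ≤ 2
γst-Kₙₙ≤2 n@(suc k) _ = subst (γst G ≤_) (cong suc (∣⁅x⁆∣≡1 b)) (γst-≤ G (⊆-max _ , dom))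
  where
  G = K n n

  -- `suc b` is vertex number `n`, the first of the second part, so `D` takes one vertex from each
  -- part. Both attain the maximum degree `n`, which settles the degree condition.
  b : Fin (k + n)
  b = k ↑ʳ zero

  b≥n : n ≤ toℕ (suc b)
  b≥n = s≤s (≤-trans (m≤m+n k 0) (≤-reflexive (sym (toℕ-↑ʳ k zero))))

  D : Subset (n + n)
  D = inside ∷ ⁅ b ⁆

  deg≤n : ∀ v → deg G v ≤ n
  deg≤n v with toℕ v <? n
  ... | yes v<n = subst (deg G v ≤_) (∣B∣≡n n n) (deg-≤ G v λ where
          (inj₁ (_ , n≤u)) → ∈B⁺ n n n≤u
          (inj₂ (n≤v , _)) → contradiction v<n (≤⇒≯ n≤v))
  ... | no v≮n = subst (deg G v ≤_) (∣A∣≡m n n) (deg-≤ G v λ where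
          (inj₁ (v<n , _)) → contradiction v<n v≮n
          (inj₂ (_ , u<n)) → ∈⟦⟧⁺ (inA? n n) u<n)

  dom : ∀ v → v ∈ V G → v ∉ D → _
  dom v _ _ with toℕ v <? n
  ... | yes v<n = suc b , there (x∈⁅x⁆ b) , inj₁ (v<n , b≥n) ,
          ≤-trans (deg≤n v) (subst (_≤ deg G (suc b)) (∣A∣≡m n n)
            (deg-≥ G (suc b) λ u∈A → inj₂ (b≥n , ∈⟦⟧⁻ (inA? n n) u∈A)))
  ... | no v≮n = zero , here , inj₂ (≮⇒≥ v≮n , z<s) ,
          ≤-trans (deg≤n v) (subst (_≤ deg G zero) (∣B∣≡n n n)
            (deg-≥ G zero λ u∈B → inj₁ (z<s , ∈B⁻ n n u∈B)))

proposition2p8 : (m n : ℕ) → 1 < m → m ≤ n →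
    (m < n → stγst (K m n) ≡ 1) ×
    (m ≡ n → 4 ≤ n → stγst (K n n) ≡ 1)
proposition2p8 m n 1<m _ = unbalanced m 1<m , λ _ → balanced n
  where
  unbalanced : ∀ m → 1 < m → m < n → stγst (K m n) ≡ 1
  -- Deleting vertex `zero` lowers `γst` from `suc m` to `m`.
  unbalanced (suc m) 1<1+m 1+m<n = stγst≡1 (K (suc m) n) zero (⊆-max _ , λ eq →
    1+n≢n (trans (sym (γst-K (suc m) n z<s 1+m<n))
      (trans (sym eq) (γst-K-0 m n (s≤s⁻¹ 1<1+m) (<⇒≤ 1+m<n)))))

  balanced : ∀ n → 4 ≤ n → stγst (K n n) ≡ 1
  -- After the deletion `γst` is `k`; equality with the old value would give `3 ≤ k ≤ 2`.
  balanced (suc k) (s≤s 3≤k) = stγst≡1 (K (suc k) (suc k)) zero (⊆-max _ , λ eq →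
    ≤⇒≯ (γst-Kₙₙ≤2 (suc k) z<s)
      (subst (3 ≤_) (trans (sym (γst-K-0 k (suc k) (≤-trans z<s 3≤k) ≤-refl)) eq) 3≤k))
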